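{- There exists an $\mathcal{O}(n)$ time algorithm that, using $\log n$ bits, generates the idempotent map $\iota\in I(n)$ corresponding to $\pi\in IP(n)$ in a separate output array from the inverse $\pi^-$ of $\pi$, where the characteristic function $\varphi^-$ is defined implicitly, i.e. fixed elements of $\pi^-$ are negative.
   Context: $[n]=\{1,\ldots,n\}$. $I(n)$ is the set of idempotent maps $\iota:[n]\to[n]$ ($\iota(\iota(x))=\iota(x)$ for all $x$). An idempotent permutation of degree $k$ ($1\le k\le n$) is a permutation $\pi$ of $[n]$ together with a distinguished set of indices $A=\{a_1<\cdots<a_k\}\subseteq[n]$ such that the values $c_i=\pi(a_i)$ satisfy $1=c_1<c_2<\cdots<c_k$; put $c_{k+1}=n+1$ and $[a_i]_\pi=\{x\in[n]:c_i\le\pi(x)<c_{i+1}\}$. $IP(n)$ denotes the set of idempotent permutations of all degrees $1\le k\le n$. The idempotent map corresponding to $\pi$ is the map $\iota$ with $\iota(x)=a_i$ for all $x\in[a_i]_\pi$, $i=1,\ldots,k$. $\pi^-$ is the inverse permutation; its fixed elements are $a_i=\pi^-(c_i)$. Its characteristic function is $\varphi^-(x)=1$ if $x\in\{c_1,\ldots,c_k\}$ and $0$ otherwise; it is "defined implicitly" when $\pi^-$ is stored in an array $D[1\ldots n]$ with $D_{c_i}=-a_i$ and $D_x=\pi^-(x)$ for all other $x$. The output is an array $E[1\ldots n]$ with $E_x=\iota(x)$. Computation is on a unit-cost random access machine; "$\log n$ bits" means that besides the input and output arrays one auxiliary variable of $\log n$ bits (an index or value of magnitude $O(n)$) is used.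 -}

module Defs where

open import Algebra.Definitions using (IdempotentFun)
open import Data.Bool using (Bool; if_then_else_)
open import Data.Fin as Fin using (Fin; toℕ; fromℕ<)
open import Data.Fin.Permutation using (Permutation′; _⟨$⟩ʳ_; _⟨$⟩ˡ_)
open import Data.Fin.Properties using (any?)
open import Data.Integer as ℤ using (ℤ; ∣_∣)
open import Data.List using (List; head; drop)
open import Data.Maybe using (Maybe; just; nothing; _>>=_)
open import Data.Nat using (ℕ; suc; _+_; _≤_; _<_; _≤?_; _<?_)
open import Data.Product using (Σ; _×_)
open import Data.Vec using (Vec; lookup; tabulate; _∷ʳ_)
open import Data.Vec.Functional using (Vector; updateAt)
open import Function using (const)
open import Relation.Binary.PropositionalEquality using (_≡_)
open import Relation.Nullary using (yes; no; does)

-- The set [n] = {1,…,n} is Fin n; the element i : Fin n stands for the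
-- number num i.
num : ∀ {n} → Fin n → ℕ
num i = suc (toℕ i)

I : ℕ → Set
I n = Σ (Fin n → Fin n) (IdempotentFun _≡_)

-- The degree k ≥ 1 is suc k-1, so a Fin.zero is a₁ and c Fin.zero is c₁.
record IP (n : ℕ) : Set where
  field
    π   : Permutation′ n
    k-1 : ℕ

  k : ℕ
  k = suc k-1

  field
    a : Fin k → Fin n

  c : Fin k → Fin n
  c i = π ⟨$⟩ʳ a i

  field
    k≤n          : k ≤ n
    a-increasing : ∀ {i j} → i Fin.< j → a i Fin.< a j
    c-increasing : ∀ {i j} → i Fin.< j → c i Fin.< c j
    c₁≡1         : num (c Fin.zero) ≡ 1

  -- c₁, …, c_k, c_{k+1} with c_{k+1} = n + 1.
  bounds : Vec ℕ (suc k)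
  bounds = tabulate (λ i → num (c i)) ∷ʳ suc n

  _∈[a_] : Fin n → Fin k → Set
  x ∈[a i ] = lookup bounds (Fin.inject₁ i) ≤ num (π ⟨$⟩ʳ x)
            × num (π ⟨$⟩ʳ x) < lookup bounds (Fin.suc i)

  φ⁻ : Fin n → Bool
  φ⁻ y = does (any? (λ i → c i Fin.≟ y))

  signedInverse : Vector ℤ n
  signedInverse y = if φ⁻ y then ℤ.- (ℤ.+ num (π ⟨$⟩ˡ y))
                            else ℤ.+ num (π ⟨$⟩ˡ y)

-- The blocks [aᵢ] partition [n] (as c₁ = 1 and c_{k+1} = n + 1), so this
-- relates exactly one map to each p.
Corresponds : ∀ {n} → IP n → (Fin n → Fin n) → Set
Corresponds p ι = ∀ i x → x ∈[a i ] → ι x ≡ a i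
  where open IP p

-- A unit-cost random access machine whose storage consists of a read-only
-- input array D[1…n], an output array E[1…n] and the single auxiliary
-- variable var.  A program is a finite list of instructions, independent
-- of n.
data Expr : Set where
  lit     : ℤ → Expr
  len     : Expr                  -- the array length n
  var     : Expr
  D[_]    : Expr → Expr
  E[_]    : Expr → Expr
  _⊕_ _⊖_ : Expr → Expr → Expr

data Instr : Set where
  var≔_       : Expr → Instr
  E[_]≔_      : Expr → Expr → Instr
  goto_if_neg : ℕ → Expr → Instr

Program : Set
Program = List Instr

-- Every literal, variable access, array access, addition and subtraction
-- costs one time unit, and so does the instruction itself.
cost : Expr → ℕ
cost (lit _) = 1
cost len     = 1
cost var     = 1
cost D[ e ]  = suc (cost e)
cost E[ e ]  = suc (cost e)
cost (e ⊕ f) = suc (cost e + cost f)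
cost (e ⊖ f) = suc (cost e + cost f)

time : Instr → ℕ
time (var≔ e)          = suc (cost e)
time (E[ e ]≔ f)       = suc (cost e + cost f)
time (goto _ if e neg) = suc (cost e)

-- The contents nothing means "not yet written".
record State (n : ℕ) : Set where
  constructor ⟨_,_,_⟩
  field
    pc        : ℕ
    auxiliary : Maybe ℤ
    output    : Vector (Maybe ℤ) n

open State public

initial : ∀ {n} → State n
initial = ⟨ 0 , nothing , const nothing ⟩

cell : ∀ {n} → ℤ → Maybe (Fin n)
cell {n} (ℤ.+ suc m) with m <? n
... | yes m<n = just (fromℕ< m<n)
... | no  _   = nothing
cell _ = nothing

-- The machine on input D with words of magnitude at most W.  Overflowing a
-- word, indexing outside 1…n and reading a location not yet written are
-- faults (nothing), so all values ever held are of magnitude at most W.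
module Machine {n : ℕ} (W : ℕ) (D : Vector ℤ n) where

  word : ℤ → Maybe ℤ
  word v with ∣ v ∣ ≤? W
  ... | yes _ = just v
  ... | no  _ = nothing

  eval : State n → Expr → Maybe ℤ
  eval s (lit v) = word v
  eval s len     = word (ℤ.+ n)
  eval s var     = auxiliary s
  eval s D[ e ]  = eval s e >>= λ v → cell v >>= λ i → word (D i)
  eval s E[ e ]  = eval s e >>= λ v → cell v >>= λ i → output s i
  eval s (e ⊕ f) = eval s e >>= λ u → eval s f >>= λ v → word (u ℤ.+ v)
  eval s (e ⊖ f) = eval s e >>= λ u → eval s f >>= λ v → word (u ℤ.- v)

  branch : ℕ → ℤ → State n → State n
  branch l v s = record s
    { pc = if does (v ℤ.<? ℤ.+ 0) then l else suc (pc s) }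

  step : Instr → State n → Maybe (State n)
  step (var≔ e) s = eval s e >>= λ v →
    just ⟨ suc (pc s) , just v , output s ⟩
  step (E[ e ]≔ f) s = eval s e >>= λ u → cell u >>= λ i → eval s f >>= λ v →
    just ⟨ suc (pc s) , auxiliary s , updateAt (output s) i (const (just v)) ⟩
  step (goto l if e neg) s = eval s e >>= λ v →
    just (branch l v s)

  fetch : Program → State n → Maybe Instr
  fetch P s = head (drop (pc s) P)

  -- P ⊢ s ⇓[ t ] s′: started in s, the program P halts without a fault in
  -- s′ after time t.  It halts when pc leaves the program.
  data _⊢_⇓[_]_ (P : Program) : State n → ℕ → State n → Set where
    halt : ∀ {s} → fetch P s ≡ nothing → P ⊢ s ⇓[ 0 ] s
    next : ∀ {s s′ s″ instr t} →
           fetch P s ≡ just instr → step instr s ≡ just s′ →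
           P ⊢ s′ ⇓[ t ] s″ → P ⊢ s ⇓[ time instr + t ] s″

-- On input D with word bound W, the program P terminates within time T and
-- leaves E_x = ι(x) for every x in the output array.
Generates : ∀ {n} → Program → (W T : ℕ) → Vector ℤ n → (Fin n → Fin n) → Set
Generates {n} P W T D ι =
  Σ ℕ λ t → Σ (State n) λ s →
    t ≤ T × P ⊢ initial ⇓[ t ] s × (∀ x → output s x ≡ just (ℤ.+ num (ι x)))
  where open Machine W D

{-# OPTIONS --safe #-}
module Submission where

-- Call a position y of π⁻ fixed if y = cᵢ for some i, and moved otherwise.
-- The positions of the block of aᵢ in π⁻ form the interval from cᵢ up to, but
-- excluding, the next fixed position.  So ι(π⁻(y)) = π⁻(y) at a fixed
-- position y, and ι(π⁻(y)) = ι(π⁻(y - 1)) at a moved one; position 1 is fixed.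
-- The program scans y = 1, …, n with y as its only variable.  No variable is
-- needed for the current aᵢ, as it can be recovered from position y - 1: it
-- is -D[y - 1] if that entry is negative and E[D[y - 1]], written in the
-- previous round, otherwise.
--
-- Leader m i says that cᵢ is the last fixed position up to m; such an i
-- exists for every m (leader) and is unique (leader-unique).  This defines ι
-- and gives the two recursion equations above (ι-fixed, ι-moved).  The loop
-- invariant Filled m says that the output is correct at the first m entries
-- of π⁻; one round extends it from m to m + 1 (round) in at most 27 time units,
-- including the jump back.  All values held are of magnitude at most n.

open import Defs
open import Algebra.Definitions using (IdempotentFun)
open import Data.Bool using (if_then_else_)
open import Data.Fin as Fin using (Fin; toℕ; fromℕ<; inject₁)
open import Data.Fin.Permutation using (_⟨$⟩ʳ_; _⟨$⟩ˡ_; inverseˡ; inverseʳ)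
open import Data.Fin.Properties using (any?; toℕ<n; toℕ-fromℕ<; fromℕ<-toℕ; toℕ-injective; toℕ-inject₁)
open import Data.Integer as ℤ using (ℤ; ∣_∣; -[1+_]; -<+)
import Data.Integer.Properties as ℤ
open import Data.List using ([]; _∷_)
open import Data.Maybe using (Maybe; just)
open import Data.Nat using (ℕ; zero; suc; pred; _+_; _*_; _∸_; _≤_; _<_; _≤?_; _<?_; _≟_; z≤n; s≤s; s≤s⁻¹)
open import Data.Nat.Properties
open import Data.Product using (Σ; ∃; ∃-syntax; _×_; _,_; proj₁; proj₂)
open import Data.Sum using (_⊎_; inj₁; inj₂)
open import Data.Vec using (Vec; lookup; tabulate; _∷_; _∷ʳ_)
open import Data.Vec.Functional using (Vector; updateAt)
open import Data.Vec.Functional.Properties using (updateAt-updates; updateAt-minimal)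
open import Data.Vec.Properties using (lookup∘tabulate)
open import Function using (const)
open import Relation.Binary.PropositionalEquality using (_≡_; _≢_; refl; sym; trans; cong; subst)
open import Relation.Nullary using (Dec; ¬_; yes; no; contradiction)
open import Relation.Nullary.Decidable using (dec-true; dec-false)

-- Blocks of an idempotent permutation

lookup-∷ʳ-inject₁ : ∀ {A : Set} {n} (xs : Vec A n) z (i : Fin n) →
                    lookup (xs ∷ʳ z) (inject₁ i) ≡ lookup xs i
lookup-∷ʳ-inject₁ (x ∷ xs) z Fin.zero    = refl
lookup-∷ʳ-inject₁ (x ∷ xs) z (Fin.suc i) = lookup-∷ʳ-inject₁ xs z i

module Blocks {n : ℕ} (p : IP n) where
  open IP p

  -- c i is the last fixed position among 0, …, m.  Positions are counted from
  -- 0 here, by toℕ rather than num, so that the first one is fixed by c₁≡1.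
  Leader : ℕ → Fin k → Set
  Leader m i = toℕ (c i) ≤ m × (∀ j → toℕ (c j) ≤ m → j Fin.≤ i)

  c-reflects-≤ : ∀ {i j} → c i Fin.≤ c j → i Fin.≤ j
  c-reflects-≤ ci≤cj = ≮⇒≥ λ j<i → <⇒≱ (c-increasing j<i) ci≤cj

  c-mono-≤ : ∀ {i j} → i Fin.≤ j → c i Fin.≤ c j
  c-mono-≤ i≤j with m≤n⇒m<n∨m≡n i≤j
  ... | inj₁ i<j = <⇒≤ (c-increasing i<j)
  ... | inj₂ i≡j = ≤-reflexive (cong (λ i → toℕ (c i)) (toℕ-injective i≡j))

  leader-unique : ∀ {m i j} → Leader m i → Leader m j → i ≡ j
  leader-unique (ci≤m , i-last) (cj≤m , j-last) =
    toℕ-injective (≤-antisym (j-last _ ci≤m) (i-last _ cj≤m))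

  leader-c : ∀ i → Leader (toℕ (c i)) i
  leader-c i = ≤-refl , λ j → c-reflects-≤ {j} {i}

  c-first : toℕ (c Fin.zero) ≡ 0
  c-first = cong pred c₁≡1

  leader-suc : ∀ {m i} → (∀ j → toℕ (c j) ≢ suc m) → Leader m i → Leader (suc m) i
  leader-suc unfixed (ci≤m , i-last) =
    m≤n⇒m≤1+n ci≤m ,
    λ j cj≤1+m → i-last j (m<1+n⇒m≤n (≤∧≢⇒< cj≤1+m (unfixed j)))

  leader : ∀ m → ∃ (Leader m)
  leader zero = Fin.zero , subst (λ m → Leader m Fin.zero) c-first (leader-c Fin.zero)
  leader (suc m) with any? (λ i → toℕ (c i) ≟ suc m)
  ... | yes (i , ci≡1+m) = i , subst (λ m → Leader m i) ci≡1+m (leader-c i)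
  ... | no  unfixed      =
    proj₁ (leader m) , leader-suc (λ j eq → unfixed (j , eq)) (proj₂ (leader m))

  -- The idempotent map corresponding to p: the element x, at position π x,
  -- goes to the aᵢ of the last fixed position up to π x.
  ι : Fin n → Fin n
  ι x = a (proj₁ (leader (toℕ (π ⟨$⟩ʳ x))))

  ι-leader : ∀ {x i} → Leader (toℕ (π ⟨$⟩ʳ x)) i → ι x ≡ a i
  ι-leader l = cong a (leader-unique (proj₂ (leader _)) l)

  ι-idempotent : IdempotentFun _≡_ ι
  ι-idempotent x = ι-leader (leader-c _)

  lookup-bounds : ∀ i → lookup bounds (inject₁ i) ≡ num (c i)
  lookup-bounds i = trans (lookup-∷ʳ-inject₁ (tabulate (λ j → num (c j))) (suc n) i)
                          (lookup∘tabulate (λ j → num (c j)) i)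

  block⇒leader : ∀ i x → x ∈[a i ] → Leader (toℕ (π ⟨$⟩ʳ x)) i
  block⇒leader i x (lower , upper) =
    s≤s⁻¹ (subst (_≤ num (π ⟨$⟩ʳ x)) (lookup-bounds i) lower) ,
    λ j cj≤πx → ≮⇒≥ λ i<j → beyond j i<j cj≤πx
    where
    -- A larger index j shows that i has a successor i⁺ ≤ j in Fin k, and the
    -- upper bound of the block is then c i⁺.
    beyond : ∀ j → i Fin.< j → ¬ (toℕ (c j) ≤ toℕ (π ⟨$⟩ʳ x))
    beyond j i<j cj≤πx = <⇒≱ (s≤s⁻¹ πx<ci⁺) (≤-trans ci⁺≤cj cj≤πx)
      where
      i⁺ : Fin k
      i⁺ = fromℕ< (≤-<-trans i<j (toℕ<n j))

      toℕ-i⁺ : toℕ i⁺ ≡ suc (toℕ i)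
      toℕ-i⁺ = toℕ-fromℕ< (≤-<-trans i<j (toℕ<n j))

      suc-i : Fin.suc i ≡ inject₁ i⁺
      suc-i = toℕ-injective (sym (trans (toℕ-inject₁ i⁺) toℕ-i⁺))

      πx<ci⁺ : num (π ⟨$⟩ʳ x) < num (c i⁺)
      πx<ci⁺ = subst (num (π ⟨$⟩ʳ x) <_)
                     (trans (cong (lookup bounds) suc-i) (lookup-bounds i⁺)) upper

      ci⁺≤cj : c i⁺ Fin.≤ c j
      ci⁺≤cj = c-mono-≤ (subst (_≤ toℕ j) (sym toℕ-i⁺) i<j)

  ι-corresponds : Corresponds p ι
  ι-corresponds i x x∈ = ι-leader (block⇒leader i x x∈)

  -- y is one of c₁, …, c_k, that is, φ⁻ y is true.
  Fixed : Fin n → Set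
  Fixed y = ∃ λ i → c i ≡ y

  fixed? : (y : Fin n) → Dec (Fixed y)
  fixed? y = any? (λ i → c i Fin.≟ y)

  -- The first round therefore never looks at a previous position.
  zero-fixed : ∀ {y} → toℕ y ≡ 0 → Fixed y
  zero-fixed y≡0 = Fin.zero , toℕ-injective (trans c-first (sym y≡0))

  signedInverse-fixed : ∀ {y} → Fixed y → signedInverse y ≡ -[1+ toℕ (π ⟨$⟩ˡ y) ]
  signedInverse-fixed {y} f =
    cong (if_then -[1+ toℕ (π ⟨$⟩ˡ y) ] else (ℤ.+ num (π ⟨$⟩ˡ y))) (dec-true (fixed? y) f)

  signedInverse-moved : ∀ {y} → ¬ Fixed y → signedInverse y ≡ ℤ.+ num (π ⟨$⟩ˡ y)
  signedInverse-moved {y} ¬f =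
    cong (if_then -[1+ toℕ (π ⟨$⟩ˡ y) ] else (ℤ.+ num (π ⟨$⟩ˡ y))) (dec-false (fixed? y) ¬f)

  ∣signedInverse∣≤n : ∀ y → ∣ signedInverse y ∣ ≤ n
  ∣signedInverse∣≤n y with fixed? y
  ... | yes f = subst (λ v → ∣ v ∣ ≤ n) (sym (signedInverse-fixed f)) (toℕ<n _)
  ... | no ¬f = subst (λ v → ∣ v ∣ ≤ n) (sym (signedInverse-moved ¬f)) (toℕ<n _)

  ι-fixed : ∀ {y} → Fixed y → ι (π ⟨$⟩ˡ y) ≡ π ⟨$⟩ˡ y
  ι-fixed (i , refl) rewrite inverseˡ π {a i} = ι-leader (leader-c i)

  ι-moved : ∀ {y z} → toℕ y ≡ num z → ¬ Fixed y → ι (π ⟨$⟩ˡ y) ≡ ι (π ⟨$⟩ˡ z)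
  ι-moved {y} {z} y≡1+z ¬f rewrite inverseʳ π {y} | inverseʳ π {z} | y≡1+z =
    cong a (leader-unique (proj₂ (leader _)) (leader-suc unfixed (proj₂ (leader _))))
    where
    unfixed : ∀ j → toℕ (c j) ≢ suc (toℕ z)
    unfixed j cj≡1+z = ¬f (j , toℕ-injective (trans cj≡1+z (sym y≡1+z)))

-- Execution of single expressions and instructions

cell-num : ∀ {n} (i : Fin n) → cell (ℤ.+ num i) ≡ just i
cell-num {n} i with toℕ i <? n
... | yes i<n = cong just (fromℕ<-toℕ i i<n)
... | no  i≮n = contradiction (toℕ<n i) i≮n

module Execution {n W : ℕ} (D : Vector ℤ n) where
  open Machine W D

  word-just : ∀ {v} → ∣ v ∣ ≤ W → word v ≡ just v
  word-just {v} v≤W with ∣ v ∣ ≤? W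
  ... | yes _   = refl
  ... | no  v≰W = contradiction v≤W v≰W

  eval-D : ∀ s e {i} → eval s e ≡ just (ℤ.+ num i) → ∣ D i ∣ ≤ W →
           eval s D[ e ] ≡ just (D i)
  eval-D s e {i} e≡i Di≤W rewrite e≡i | cell-num i = word-just Di≤W

  eval-E : ∀ s e {i} → eval s e ≡ just (ℤ.+ num i) → eval s E[ e ] ≡ output s i
  eval-E s e {i} e≡i rewrite e≡i | cell-num i = refl

  eval-⊕ : ∀ s e f {u v} → eval s e ≡ just u → eval s f ≡ just v →
           ∣ u ℤ.+ v ∣ ≤ W → eval s (e ⊕ f) ≡ just (u ℤ.+ v)
  eval-⊕ s e f e≡u f≡v u+v≤W rewrite e≡u | f≡v = word-just u+v≤W

  eval-⊖ : ∀ s e f {u v} → eval s e ≡ just u → eval s f ≡ just v →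
           ∣ u ℤ.- v ∣ ≤ W → eval s (e ⊖ f) ≡ just (u ℤ.- v)
  eval-⊖ s e f e≡u f≡v u-v≤W rewrite e≡u | f≡v = word-just u-v≤W

  module _ {P : Program} {s s′ : State n} {t : ℕ} where

    assign : ∀ e {v} → fetch P s ≡ just (var≔ e) → eval s e ≡ just v →
             P ⊢ ⟨ suc (pc s) , just v , output s ⟩ ⇓[ t ] s′ →
             P ⊢ s ⇓[ time (var≔ e) + t ] s′
    assign e {v} fetched e≡v = next fetched stepped
      where
      stepped : step (var≔ e) s ≡ just ⟨ suc (pc s) , just v , output s ⟩
      stepped rewrite e≡v = refl

    store : ∀ e f {i v} → fetch P s ≡ just (E[ e ]≔ f) →
            eval s e ≡ just (ℤ.+ num i) → eval s f ≡ just v →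
            P ⊢ ⟨ suc (pc s) , auxiliary s , updateAt (output s) i (const (just v)) ⟩ ⇓[ t ] s′ →
            P ⊢ s ⇓[ time (E[ e ]≔ f) + t ] s′
    store e f {i} {v} fetched e≡i f≡v = next fetched stepped
      where
      stepped : step (E[ e ]≔ f) s ≡
                just ⟨ suc (pc s) , auxiliary s , updateAt (output s) i (const (just v)) ⟩
      stepped rewrite e≡i | cell-num i | f≡v = refl

    jump : ∀ l e {v} → fetch P s ≡ just (goto l if e neg) →
           eval s e ≡ just v → v ℤ.< ℤ.+ 0 →
           P ⊢ ⟨ l , auxiliary s , output s ⟩ ⇓[ t ] s′ →
           P ⊢ s ⇓[ time (goto l if e neg) + t ] s′
    jump l e {v} fetched e≡v v<0 = next fetched stepped
      where
      stepped : step (goto l if e neg) s ≡ just ⟨ l , auxiliary s , output s ⟩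
      stepped rewrite e≡v =
        cong (λ b → just ⟨ if b then l else suc (pc s) , auxiliary s , output s ⟩)
             (dec-true (v ℤ.<? ℤ.+ 0) v<0)

    fall-through : ∀ l e {v} → fetch P s ≡ just (goto l if e neg) →
                   eval s e ≡ just v → ¬ (v ℤ.< ℤ.+ 0) →
                   P ⊢ ⟨ suc (pc s) , auxiliary s , output s ⟩ ⇓[ t ] s′ →
                   P ⊢ s ⇓[ time (goto l if e neg) + t ] s′
    fall-through l e {v} fetched e≡v v≮0 = next fetched stepped
      where
      stepped : step (goto l if e neg) s ≡ just ⟨ suc (pc s) , auxiliary s , output s ⟩
      stepped rewrite e≡v =
        cong (λ b → just ⟨ if b then l else suc (pc s) , auxiliary s , output s ⟩)
             (dec-false (v ℤ.<? ℤ.+ 0) v≮0)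

-- The program and its loop

-- The position before the current one.
prev : Expr
prev = var ⊖ lit (ℤ.+ 1)

-- Minus the entry of D at e.
-D[_] : Expr → Expr
-D[ e ] = lit (ℤ.+ 0) ⊖ D[ e ]

-- The variable holds the position, counted from 1.  A round enters at
-- instruction 1, which advances the position, and ends at instruction 9.
-- Instruction 4 handles a moved position after a moved one, instruction 6 a
-- moved position after a fixed one, and instruction 8 a fixed position.  The
-- jumps at 5 and 7 are unconditional.
program : Program
program =
  (var≔ lit (ℤ.+ 0)) ∷
  (var≔ (lit (ℤ.+ 1) ⊕ var)) ∷
  goto 8 if D[ var ] neg ∷
  goto 6 if D[ prev ] neg ∷
  (E[ D[ var ] ]≔ E[ D[ prev ] ]) ∷
  goto 9 if lit -[1+ 0 ] neg ∷
  (E[ D[ var ] ]≔ -D[ prev ]) ∷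
  goto 9 if lit -[1+ 0 ] neg ∷
  (E[ -D[ var ] ]≔ -D[ var ]) ∷
  goto 1 if var ⊖ len neg ∷
  []

previous : ∀ {n} (y : Fin n) → toℕ y ≡ 0 ⊎ ∃ λ (z : Fin n) → toℕ y ≡ num z
previous Fin.zero    = inj₁ refl
previous (Fin.suc z) = inj₂ (inject₁ z , cong suc (sym (toℕ-inject₁ z)))

module Correctness {n : ℕ} (p : IP n) {W : ℕ} (n≤W : n ≤ W) where
  open IP p
  open Blocks p
  open Machine W signedInverse
  open Execution {W = W} signedInverse

  π⁻ : Fin n → Fin n
  π⁻ = π ⟨$⟩ˡ_

  -- The loop invariant: the output is correct at the first m entries of π⁻.
  Filled : ℕ → Vector (Maybe ℤ) n → Set
  Filled m out = ∀ x → toℕ (π ⟨$⟩ʳ x) < m → out x ≡ just (ℤ.+ num (ι x))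

  -- The output array after the correct value for the entry π⁻ y is stored.
  write : Vector (Maybe ℤ) n → Fin n → Vector (Maybe ℤ) n
  write out y = updateAt out (π⁻ y) (const (just (ℤ.+ num (ι (π⁻ y)))))

  fill : ∀ {out} y → Filled (toℕ y) out → Filled (suc (toℕ y)) (write out y)
  fill {out} y filled x πx≤y with x Fin.≟ π⁻ y
  ... | yes refl = updateAt-updates (π⁻ y) out
  ... | no  x≢   = trans (updateAt-minimal x (π⁻ y) out x≢)
                         (filled x (≤∧≢⇒< (s≤s⁻¹ πx≤y) πx≢y))
    where
    πx≢y : toℕ (π ⟨$⟩ʳ x) ≢ toℕ y
    πx≢y eq = x≢ (trans (sym (inverseˡ π)) (cong π⁻ (toℕ-injective eq)))

  eval-D-fixed : ∀ s e {y} → eval s e ≡ just (ℤ.+ num y) → Fixed y →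
                 eval s D[ e ] ≡ just -[1+ toℕ (π⁻ y) ]
  eval-D-fixed s e {y} e≡y f =
    trans (eval-D s e e≡y (≤-trans (∣signedInverse∣≤n y) n≤W))
          (cong just (signedInverse-fixed f))

  eval-D-moved : ∀ s e {y} → eval s e ≡ just (ℤ.+ num y) → ¬ Fixed y →
                 eval s D[ e ] ≡ just (ℤ.+ num (π⁻ y))
  eval-D-moved s e {y} e≡y ¬f =
    trans (eval-D s e e≡y (≤-trans (∣signedInverse∣≤n y) n≤W))
          (cong just (signedInverse-moved ¬f))

  num≤W : (i : Fin n) → num i ≤ W
  num≤W i = ≤-trans (toℕ<n i) n≤W

  -- The literals of the program fit into a word because n is positive.
  1≤W : 1 ≤ W
  1≤W = ≤-trans (s≤s z≤n) (num≤W (a Fin.zero))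

  eval-negated-D : ∀ s e {y} → eval s e ≡ just (ℤ.+ num y) → Fixed y →
                   eval s -D[ e ] ≡ just (ℤ.+ num (π⁻ y))
  eval-negated-D s e e≡y f =
    eval-⊖ s (lit (ℤ.+ 0)) D[ e ] {u = ℤ.+ 0} (word-just z≤n) (eval-D-fixed s e e≡y f) (num≤W _)

  -- One round, up to the test for another one: it takes m done positions to
  -- m + 1 in time at most 23, the maximum over the three branches.  The
  -- execution is given by its effect on any run that continues it.
  Round : ℕ → Set
  Round m = ∀ {out} → Filled m out →
    ∃ λ out′ → Filled (suc m) out′ × ∃ λ t → t ≤ 23 ×
      (∀ {t′ s′} → program ⊢ ⟨ 9 , just (ℤ.+ suc m) , out′ ⟩ ⇓[ t′ ] s′ →
                   program ⊢ ⟨ 1 , just (ℤ.+ m) , out ⟩ ⇓[ t + t′ ] s′)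

  round-at : (y : Fin n) → Round (toℕ y)
  round-at y {out} filled = write out y , fill y filled , body
    where
    -- The state from instruction 2 until the store: only pc changes.
    at : ℕ → State n
    at l = ⟨ l , just (ℤ.+ num y) , out ⟩

    -- The execution part of Round, with the output array made explicit.
    Body : Set
    Body = ∃ λ t → t ≤ 23 ×
      (∀ {t′ s′} → program ⊢ ⟨ 9 , just (ℤ.+ num y) , write out y ⟩ ⇓[ t′ ] s′ →
                   program ⊢ ⟨ 1 , just (ℤ.+ toℕ y) , out ⟩ ⇓[ t + t′ ] s′)

    advance : ∀ {t s′} → program ⊢ at 2 ⇓[ t ] s′ →
              program ⊢ ⟨ 1 , just (ℤ.+ toℕ y) , out ⟩ ⇓[ 4 + t ] s′
    advance = assign (lit (ℤ.+ 1) ⊕ var) refl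
      (eval-⊕ ⟨ 1 , just (ℤ.+ toℕ y) , out ⟩ (lit (ℤ.+ 1)) var (word-just 1≤W) refl (num≤W y))

    eval-previous : ∀ l {z : Fin n} → toℕ y ≡ num z →
                    eval (at l) prev ≡ just (ℤ.+ num z)
    eval-previous l y≡1+z = trans
      (eval-⊖ (at l) var (lit (ℤ.+ 1)) refl (word-just 1≤W) (<⇒≤ (num≤W y)))
      (cong (λ m → just (ℤ.+ m)) y≡1+z)

    body-fixed : Fixed y → Body
    body-fixed f = 16 , m≤m+n 16 7 , λ run →
      advance
      (jump 8 D[ var ] refl (eval-D-fixed (at 2) var refl f) -<+
      (store -D[ var ] -D[ var ] refl
        (eval-negated-D (at 8) var refl f)
        (trans (eval-negated-D (at 8) var refl f)
               (cong (λ x → just (ℤ.+ num x)) (sym (ι-fixed f))))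
      run))

    body-moved : ¬ Fixed y → ∀ z → toℕ y ≡ num z → Body
    body-moved ¬f z y≡1+z with fixed? z
    ... | yes g = 23 , ≤-refl , λ run →
      advance
      (fall-through 8 D[ var ] refl (eval-D-moved (at 2) var refl ¬f) ℤ.+≮0
      (jump 6 D[ prev ] refl
        (eval-D-fixed (at 3) prev (eval-previous 3 y≡1+z) g) -<+
      (store D[ var ] -D[ prev ] refl
        (eval-D-moved (at 6) var refl ¬f)
        (trans (eval-negated-D (at 6) prev (eval-previous 6 y≡1+z) g)
               (cong (λ x → just (ℤ.+ num x)) (sym (trans (ι-moved y≡1+z ¬f) (ι-fixed g)))))
      (jump 9 (lit -[1+ 0 ]) refl (word-just 1≤W) -<+
      run))))
    ... | no ¬g = 22 , m≤m+n 22 1 , λ run →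
      advance
      (fall-through 8 D[ var ] refl (eval-D-moved (at 2) var refl ¬f) ℤ.+≮0
      (fall-through 6 D[ prev ] refl
        (eval-D-moved (at 3) prev (eval-previous 3 y≡1+z) ¬g) ℤ.+≮0
      (store D[ var ] E[ D[ prev ] ] refl
        (eval-D-moved (at 4) var refl ¬f)
        (trans (eval-E (at 4) D[ prev ]
                 (eval-D-moved (at 4) prev (eval-previous 4 y≡1+z) ¬g))
        (trans (filled (π⁻ z) πz<y)
               (cong (λ x → just (ℤ.+ num x)) (sym (ι-moved y≡1+z ¬f)))))
      (jump 9 (lit -[1+ 0 ]) refl (word-just 1≤W) -<+
      run))))
      where
      πz<y : toℕ (π ⟨$⟩ʳ π⁻ z) < toℕ y
      πz<y = ≤-reflexive (trans (cong num (inverseʳ π)) (sym y≡1+z))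

    body : Body
    body with fixed? y
    ... | yes f = body-fixed f
    ... | no ¬f with previous y
    ...   | inj₁ y≡0         = contradiction (zero-fixed y≡0) ¬f
    ...   | inj₂ (z , y≡1+z) = body-moved ¬f z y≡1+z

  round : ∀ {m} → m < n → Round m
  round m<n = subst Round (toℕ-fromℕ< m<n) (round-at (fromℕ< m<n))

  -- From s the program halts within time T with the output array correct.
  Finishes : (T : ℕ) → State n → Set
  Finishes T s = Σ ℕ λ t → Σ (State n) λ s′ →
    t ≤ T × program ⊢ s ⇓[ t ] s′ × (∀ x → output s′ x ≡ just (ℤ.+ num (ι x)))

  eval-remaining : ∀ {m out} → m ≤ n →
    eval ⟨ 9 , just (ℤ.+ m) , out ⟩ (var ⊖ len) ≡ just (ℤ.+ m ℤ.- ℤ.+ n)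
  eval-remaining {m} {out} m≤n =
    eval-⊖ ⟨ 9 , just (ℤ.+ m) , out ⟩ var len refl (word-just n≤W) m-n≤W
    where
    m-n≤W : ∣ ℤ.+ m ℤ.- ℤ.+ n ∣ ≤ W
    m-n≤W rewrite ℤ.m-n≡m⊖n m n | ℤ.∣⊖∣-≤ m≤n = ≤-trans (m∸n≤m n m) n≤W

  -- With m positions done and r + 1 rounds to go.  The test that ends a round
  -- costs 4, so that a round costs at most 23 + 4 = 27.
  loop : ∀ r m {out} → m + suc r ≡ n → Filled m out →
         Finishes (suc r * 27) ⟨ 1 , just (ℤ.+ m) , out ⟩
  loop r m {out} m+1+r≡n filled
    with round {m} (subst (m <_) m+1+r≡n (m<m+n m (s≤s z≤n))) filled
  loop zero m m+1≡n filled | out′ , filled′ , t , t≤23 , prepend =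
    t + 4 , ⟨ 10 , just (ℤ.+ suc m) , out′ ⟩ , +-monoˡ-≤ 4 t≤23 ,
    prepend (fall-through 1 (var ⊖ len) refl
      (eval-remaining {out = out′} (≤-reflexive 1+m≡n)) nonneg (halt refl)) ,
    λ x → filled′ x (subst (toℕ (π ⟨$⟩ʳ x) <_) (sym 1+m≡n) (toℕ<n _))
    where
    1+m≡n : suc m ≡ n
    1+m≡n = trans (+-comm 1 m) m+1≡n

    nonneg : ¬ (ℤ.+ suc m ℤ.- ℤ.+ n ℤ.< ℤ.+ 0)
    nonneg rewrite 1+m≡n | ℤ.+-inverseʳ (ℤ.+ n) = ℤ.<-irrefl refl
  loop (suc r) m m+2+r≡n filled | out′ , filled′ , t , t≤23 , prepend
    with loop r (suc m) (trans (sym (+-suc m (suc r))) m+2+r≡n) filled′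
  ... | t′ , s′ , t′≤ , run , correct =
    t + (4 + t′) , s′ ,
    subst (_≤ suc (suc r) * 27) (+-assoc t 4 t′) (+-mono-≤ (+-monoˡ-≤ 4 t≤23) t′≤) ,
    prepend (jump 1 (var ⊖ len) refl (eval-remaining {out = out′} (<⇒≤ 1+m<n)) neg run) ,
    correct
    where
    1+m<n : suc m < n
    1+m<n = subst (suc m <_) (trans (sym (+-suc m (suc r))) m+2+r≡n)
                  (m<m+n (suc m) (s≤s z≤n))

    neg : ℤ.+ suc m ℤ.- ℤ.+ n ℤ.< ℤ.+ 0
    neg = subst (ℤ.+ suc m ℤ.- ℤ.+ n ℤ.<_) (ℤ.+-inverseʳ (ℤ.+ n))
                (ℤ.+-monoˡ-< (ℤ.- ℤ.+ n) (ℤ.+<+ 1+m<n))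

  1≤n : 1 ≤ n
  1≤n = ≤-trans (s≤s z≤n) (toℕ<n (a Fin.zero))

  -- The initial assignment costs 2 ≤ 2n, which makes 27n into 29n.
  generates : Generates program W (29 * n) signedInverse ι
  generates with loop (n ∸ 1) 0 (m+[n∸m]≡n 1≤n) (λ _ ())
  ... | t , s , t≤ , run , correct =
    2 + t , s , 2+t≤29n ,
    assign (lit (ℤ.+ 0)) refl (word-just {ℤ.+ 0} z≤n) run , correct
    where
    2+t≤29n : 2 + t ≤ 29 * n
    2+t≤29n = begin
      2 + t                      ≤⟨ +-mono-≤ (*-monoʳ-≤ 2 1≤n) t≤ ⟩
      2 * n + suc (n ∸ 1) * 27   ≡⟨ cong (λ m → 2 * n + m * 27) (m+[n∸m]≡n 1≤n) ⟩
      2 * n + n * 27             ≡⟨ cong (2 * n +_) (*-comm n 27) ⟩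
      2 * n + 27 * n             ≡⟨ *-distribʳ-+ n 2 27 ⟨
      29 * n                     ∎
      where open ≤-Reasoning

theorem3p16 : ∃[ P ] ∃[ C ] ∃[ w ]
    ((n : ℕ) (p : IP n) →
    Σ (I n) λ ι →
    Corresponds p (proj₁ ι) ×
    Generates P (w * n) (C * n) (IP.signedInverse p) (proj₁ ι))
theorem3p16 = program , 29 , 1 , λ n p →
  let open Blocks p in
  (ι , ι-idempotent) , ι-corresponds ,
  Correctness.generates p (≤-reflexive (sym (*-identityˡ n)))
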